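{- An equivalence relation $E^{\mathrm{ce}}$ on $\omega$ extending $=^{\mathrm{ce}}$ is universal if and only if $E^{\mathrm{ce}}$ has the locking property.
   Context: Fix a standard (acceptable) enumeration $(\varphi_e)_{e\in\omega}$ of the partial computable functions and let $W_e=\operatorname{dom}(\varphi_e)$. Write $e=^{\mathrm{ce}}e'$ iff $W_e=W_{e'}$. Equivalence relations on $\omega$ extending $=^{\mathrm{ce}}$ are arbitrary (no definability or effectivity is assumed). An enumeration of a set $A$ is a surjection $\mu:\omega\to A$; $\mu[s]$ denotes the finite string $\mu(0),\dots,\mu(s-1)$. A learner is an arbitrary function $\mathbf{M}:\omega^{<\omega}\to\omega$ (no effectivity is assumed). A family $\mathfrak{K}$ of nonempty c.e. sets is $E^{\mathrm{ce}}$-learnable if there is a learner $\mathbf{M}$ such that for every $e$ with $W_e\in\mathfrak{K}$ and every enumeration $\mu$ of $W_e$ there is $i\in\omega$ with $i\mathrel{E^{\mathrm{ce}}}e$ and $\mathbf{M}(\mu[s])=i$ for all sufficiently large $s$. $E^{\mathrm{ce}}$ is universal if every family of nonempty c.e. sets is $E^{\mathrm{ce}}$-learnable (equivalently, $\{W_e:e\in\omega,\ W_e\neq\emptyset\}$ is $E^{\mathrm{ce}}$-learnable). $E^{\mathrm{ce}}$ has the locking property if for every nonempty c.e. set $W_e$ and every (not necessarily computable) sequence $(b_i)_{i\in\omega}$ of indices such that $W_{b_i}$ is finite for every $i$, $W_{b_i}\subseteq W_{b_{i+1}}$ for every $i$, and $\bigcup_{i\in\omega}W_{b_i}=W_e$,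 there exists $k\in\omega$ such that $b_i\mathrel{E^{\mathrm{ce}}}e$ for all $i\geq k$. -}

module Defs where

open import Data.Fin using (Fin)
open import Data.List using (List; applyUpTo)
open import Data.List.Membership.Propositional using () renaming (_∈_ to _∈ₗ_)
open import Data.Nat using (ℕ; zero; suc; _≤_; _<_)
open import Data.Product using (∃; _×_)
open import Data.Vec using (Vec; []; _∷_; lookup)
open import Data.Vec.Relation.Binary.Pointwise.Inductive using (Pointwise)
open import Function.Bundles using (_⇔_)
open import Level using (0ℓ)
open import Relation.Binary.Core using (Rel)
open import Relation.Binary.Definitions using (_Respects_)
open import Relation.Binary.PropositionalEquality using (_≡_)
open import Relation.Unary using (Pred; _∈_; _⊆_; _≐_; Satisfiable; ⋃)

private
  variable
    k n : ℕ

------------------------------------------------------------------------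
-- Partial computable functions

-- Terms for the n-ary μ-recursive functions.
data Rec : ℕ → Set where
  zeroᶠ : Rec n
  sucᶠ  : Rec 1
  proj  : Fin n → Rec n
  comp  : Rec k → Vec (Rec n) k → Rec n
  prec  : Rec n → Rec (suc (suc n)) → Rec (suc n)
  min   : Rec (suc n) → Rec n

infix 4 _[_]⇓_

-- c [ xs ]⇓ y: the partial function computed by c is defined at xs, with
-- value y.  As usual for minimisation, min c requires c to be defined and
-- nonzero at all arguments below the first zero.
data _[_]⇓_ : Rec n → Vec ℕ n → ℕ → Set where
  zero⇓  : {xs : Vec ℕ n} → zeroᶠ [ xs ]⇓ 0
  suc⇓   : ∀ {x} → sucᶠ [ x ∷ [] ]⇓ suc x
  proj⇓  : {i : Fin n} {xs : Vec ℕ n} → proj i [ xs ]⇓ lookup xs i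
  comp⇓  : {c : Rec k} {ds : Vec (Rec n) k} {xs : Vec ℕ n} {ys : Vec ℕ k} {z : ℕ} →
           Pointwise (λ d y → d [ xs ]⇓ y) ds ys → c [ ys ]⇓ z →
           comp c ds [ xs ]⇓ z
  prec⇓₀ : {c : Rec n} {d : Rec (suc (suc n))} {xs : Vec ℕ n} {y : ℕ} →
           c [ xs ]⇓ y →
           prec c d [ zero ∷ xs ]⇓ y
  prec⇓₊ : {c : Rec n} {d : Rec (suc (suc n))} {xs : Vec ℕ n} {m r y : ℕ} →
           prec c d [ m ∷ xs ]⇓ r → d [ m ∷ r ∷ xs ]⇓ y →
           prec c d [ suc m ∷ xs ]⇓ y
  min⇓   : {c : Rec (suc n)} {xs : Vec ℕ n} {y : ℕ} →
           c [ y ∷ xs ]⇓ 0 →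
           (∀ z → z < y → ∃ λ w → c [ z ∷ xs ]⇓ suc w) →
           min c [ xs ]⇓ y

-- A partial function is given by its graph: φ e x y says that φₑ(x) is
-- defined and equal to y.  Acceptability is the enumeration property plus
-- the parametrisation (s-m-n) property.  Together they imply that the φₑ
-- are exactly the unary partial computable functions: universal gives one
-- inclusion, and parametrise, applied to a ψ ignoring its first argument,
-- gives the other.
record AcceptableEnumeration : Set₁ where
  field
    φ : ℕ → ℕ → ℕ → Set

    universal :
      ∃ λ (u : Rec 2) → ∀ e x y → φ e x y ⇔ u [ e ∷ x ∷ [] ]⇓ y

    parametrise :
      (ψ : Rec 2) →
      ∃ λ (s : ℕ → ℕ) →
        (∃ λ (c : Rec 1) → ∀ e → c [ e ∷ [] ]⇓ s e) ×
        (∀ e x y → φ (s e) x y ⇔ ψ [ e ∷ x ∷ [] ]⇓ y)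

------------------------------------------------------------------------
-- Enumerations and learners

Finite : Pred ℕ 0ℓ → Set
Finite A = ∃ λ (xs : List ℕ) → A ≐ (_∈ₗ xs)

-- μ is a surjection from ω onto A.
_Enumerates_ : (ℕ → ℕ) → Pred ℕ 0ℓ → Set
μ Enumerates A = (∀ s → μ s ∈ A) × (∀ {x} → x ∈ A → ∃ λ s → μ s ≡ x)

infix 9 _↾_

-- The finite string μ[s] = μ(0), …, μ(s-1).
_↾_ : (ℕ → ℕ) → ℕ → List ℕ
μ ↾ s = applyUpTo μ s

Learner : Set
Learner = List ℕ → ℕ

module _ (N : AcceptableEnumeration) where
  open AcceptableEnumeration N

  W : ℕ → Pred ℕ 0ℓ
  W e x = ∃ λ y → φ e x y

  EqCE : Rel ℕ 0ℓ
  EqCE e e′ = W e ≐ W e′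

  CE : Pred ℕ 0ℓ → Set
  CE A = ∃ λ e → W e ≐ A

  -- Predicates are not extensional in Agda, so a set of sets of naturals
  -- has to be required to respect ≐.
  record Family : Set₁ where
    field
      member   : Pred (Pred ℕ 0ℓ) 0ℓ
      respects : member Respects _≐_
      nonempty : ∀ {A} → A ∈ member → Satisfiable A
      ce       : ∀ {A} → A ∈ member → CE A

  module _ (E : Rel ℕ 0ℓ) where

    Learns : Learner → Family → Set
    Learns M 𝔎 =
      ∀ e → W e ∈ Family.member 𝔎 →
      ∀ μ → μ Enumerates W e →
      ∃ λ i → E i e × ∃ λ s₀ → ∀ s → s₀ ≤ s → M (μ ↾ s) ≡ i

    Learnable : Family → Set
    Learnable 𝔎 = ∃ λ M → Learns M 𝔎

    Universal : Set₁
    Universal = ∀ 𝔎 → Learnable 𝔎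

    LockingProperty : Set
    LockingProperty =
      ∀ e → Satisfiable (W e) →
      (b : ℕ → ℕ) →
      (∀ i → Finite (W (b i))) →
      (∀ i → W (b i) ⊆ W (b (suc i))) →
      ⋃ ℕ (λ i → W (b i)) ≐ W e →
      ∃ λ k → ∀ i → k ≤ i → E (b i) e

{-# OPTIONS --safe #-}

-- Locking ⇒ universal: conjecture the E-least index of the finite set seen so
-- far.  Along an enumeration of W e these finite sets increase to W e, so their
-- indices are eventually E-equivalent to e, and E-equivalent indices have the
-- same E-least index.
--
-- Universal ⇒ locking: a learner of all nonempty c.e. sets has, for each W e, a
-- string σ over W e all of whose extensions over W e give the same conjecture;
-- otherwise extensions changing the conjecture could be interleaved with W e to
-- give an enumeration along which the learner does not converge.  As σ starts
-- enumerations of W e and of every W (b i) containing the entries of σ, its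
-- conjecture is E-equivalent to e and to b i.
module Submission where

open import Defs
open import Axiom.ExcludedMiddle using (ExcludedMiddle)
open import Data.Fin using (zero; suc)
open import Data.List using (List; []; _∷_; _++_; _∷ʳ_; length; map; applyUpTo)
open import Data.List.Membership.Propositional using () renaming (_∈_ to _∈ₗ_)
open import Data.List.Membership.Propositional.Properties using (∈-applyUpTo⁺; ∈-applyUpTo⁻; ∈-++⁺ʳ; ∈-++⁺ˡ)
open import Data.List.Properties using (++-assoc; ++-identityʳ; length-applyUpTo; applyUpTo-∷ʳ; map-applyUpTo; ∷-injective)
open import Data.List.Relation.Unary.All using (All; []; _∷_)
open import Data.List.Relation.Unary.Any using (here; there)
open import Data.Nat using (ℕ; zero; suc; _+_; _≤_; _<_; s≤s; _≟_; _⊔_; _≤′_; ≤′-refl; ≤′-step)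
open import Data.Nat.Properties using (≤-trans; m≤n+m; n<1+n; +-suc; m≤m⊔n; m≤n⊔m; ≤⇒≤′; <-cmp; 0≢1+n; suc-injective)
open import Data.Product using (∃; _×_; _,_; proj₁; proj₂)
open import Data.Vec using (Vec; []; _∷_)
open import Data.Vec.Relation.Binary.Pointwise.Inductive using (Pointwise; []; _∷_)
open import Function.Base using (_∘_)
open import Function.Bundles using (_⇔_; mk⇔; Equivalence)
open import Level using (0ℓ)
open import Relation.Binary.Core using (Rel; _⇒_)
open import Relation.Binary.Definitions using (tri<; tri≈; tri>)
open import Relation.Binary.PropositionalEquality using (_≡_; _≢_; refl; sym; trans; cong; cong₂; subst; module ≡-Reasoning)
open import Relation.Binary.Structures using (IsEquivalence)
open import Relation.Nullary using (¬_; yes; no; contradiction)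
open import Relation.Nullary.Decidable using (decidable-stable)
open import Relation.Unary using (Pred; Decidable; _∈_; _⊆_; _≐_; Satisfiable)

open Equivalence using (to; from)

-- Indices of finite sets

-- In the case of `min`, the smaller of two distinct values would be an argument at which `c` is
-- both zero and nonzero.
⇓-deterministic : ∀ {n} (c : Rec n) {xs y z} → c [ xs ]⇓ y → c [ xs ]⇓ z → y ≡ z
⇓-deterministic* : ∀ {n k} (ds : Vec (Rec n) k) {xs ys zs} →
                   Pointwise (λ d y → d [ xs ]⇓ y) ds ys →
                   Pointwise (λ d y → d [ xs ]⇓ y) ds zs → ys ≡ zs

⇓-deterministic zeroᶠ zero⇓ zero⇓ = refl
⇓-deterministic sucᶠ suc⇓ suc⇓ = refl
⇓-deterministic (proj i) proj⇓ proj⇓ = refl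
⇓-deterministic (comp c ds) (comp⇓ ps p) (comp⇓ qs q)
  rewrite ⇓-deterministic* ds ps qs = ⇓-deterministic c p q
⇓-deterministic (prec c d) (prec⇓₀ p) (prec⇓₀ q) = ⇓-deterministic c p q
⇓-deterministic (prec c d) (prec⇓₊ p p⁺) (prec⇓₊ q q⁺)
  rewrite ⇓-deterministic (prec c d) p q = ⇓-deterministic d p⁺ q⁺
⇓-deterministic (min c) {y = y} {z} (min⇓ p below-y) (min⇓ q below-z) with <-cmp y z
... | tri< y<z _ _ = contradiction (⇓-deterministic c p (proj₂ (below-z y y<z))) 0≢1+n
... | tri≈ _ y≡z _ = y≡z
... | tri> _ _ z<y = contradiction (⇓-deterministic c q (proj₂ (below-y z z<y))) 0≢1+n

⇓-deterministic* [] [] [] = refl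
⇓-deterministic* (d ∷ ds) (p ∷ ps) (q ∷ qs) =
  cong₂ _∷_ (⇓-deterministic d p q) (⇓-deterministic* ds ps qs)

-- Truth is coded by 0, the value that minimisation searches for.
Decides : Rec 1 → Pred ℕ 0ℓ → Set
Decides c P = ∀ x → ∃ λ v → c [ x ∷ [] ]⇓ v × (v ≡ 0 ⇔ P x)

oneᶠ : ∀ {n} → Rec n
oneᶠ = comp sucᶠ (zeroᶠ ∷ [])

one⇓ : ∀ {n} {xs : Vec ℕ n} → oneᶠ [ xs ]⇓ 1
one⇓ = comp⇓ (zero⇓ ∷ []) suc⇓

-- Primitive recursion serves as case distinction: its recursive value is discarded, and the actual
-- recursion is on the constant `a`.
equalᶠ : ℕ → Rec 1
equalᶠ zero    = prec zeroᶠ oneᶠ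
equalᶠ (suc a) = prec oneᶠ (comp (equalᶠ a) (proj zero ∷ []))

equalᶠ-decides : ∀ a → Decides (equalᶠ a) (a ≡_)
equalᶠ-decides zero zero = 0 , prec⇓₀ zero⇓ , mk⇔ (λ _ → refl) (λ _ → refl)
equalᶠ-decides zero (suc x) with equalᶠ-decides zero x
... | _ , r , _ = 1 , prec⇓₊ r one⇓ , mk⇔ (λ ()) (λ ())
equalᶠ-decides (suc a) zero = 1 , prec⇓₀ one⇓ , mk⇔ (λ ()) (λ ())
equalᶠ-decides (suc a) (suc x) with equalᶠ-decides (suc a) x | equalᶠ-decides a x
... | _ , r , _ | v , d , v≡0⇔a≡x =
  v , prec⇓₊ r (comp⇓ (proj⇓ ∷ []) d) ,
  mk⇔ (cong suc ∘ to v≡0⇔a≡x) (from v≡0⇔a≡x ∘ suc-injective)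

-- As 0 codes truth, this acts as disjunction in `memberᶠ`; it is conjunction when nonzero values
-- count as true.
andᶠ : Rec 2
andᶠ = prec zeroᶠ (proj (suc (suc zero)))

andᶠ-suc : ∀ m {w} → andᶠ [ suc m ∷ w ∷ [] ]⇓ w
andᶠ-suc zero    = prec⇓₊ (prec⇓₀ zero⇓) proj⇓
andᶠ-suc (suc m) = prec⇓₊ (andᶠ-suc m) proj⇓

memberᶠ : List ℕ → Rec 1
memberᶠ []       = oneᶠ
memberᶠ (a ∷ as) = comp andᶠ (equalᶠ a ∷ memberᶠ as ∷ [])

memberᶠ-decides : ∀ as → Decides (memberᶠ as) (_∈ₗ as)
memberᶠ-decides [] x = 1 , one⇓ , mk⇔ (λ ()) (λ ())
memberᶠ-decides (a ∷ as) x with equalᶠ-decides a x | memberᶠ-decides as x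
... | zero , p , a≡x⇔ | w , q , _ =
  0 , comp⇓ (p ∷ q ∷ []) (prec⇓₀ zero⇓) ,
  mk⇔ (λ eq → here (sym (to a≡x⇔ eq))) (λ _ → refl)
... | suc v , p , a≡x⇔ | w , q , x∈as⇔ =
  w , comp⇓ (p ∷ q ∷ []) (andᶠ-suc v) , mk⇔ (there ∘ to x∈as⇔) back
  where
  back : x ∈ₗ a ∷ as → w ≡ 0
  back (here x≡a)   = contradiction (sym (from a≡x⇔ (sym x≡a))) 0≢1+n
  back (there x∈as) = from x∈as⇔ x∈as

-- The minimisation variable comes first and the index, which is ignored,
-- second.
semimemberᶠ : List ℕ → Rec 2
semimemberᶠ as = min (comp (memberᶠ as) (proj (suc (suc zero)) ∷ []))

-- The function being minimised is constant in the minimisation variable, so the search either stops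
-- at 0 or never stops.
semimemberᶠ-domain : ∀ as e x → (∃ λ y → semimemberᶠ as [ e ∷ x ∷ [] ]⇓ y) ⇔ x ∈ₗ as
semimemberᶠ-domain as e x with memberᶠ-decides as x
... | v , p , v≡0⇔ = mk⇔ forth back
  where
  forth : (∃ λ y → semimemberᶠ as [ e ∷ x ∷ [] ]⇓ y) → x ∈ₗ as
  forth (_ , min⇓ (comp⇓ (proj⇓ ∷ []) q) _) = to v≡0⇔ (⇓-deterministic (memberᶠ as) p q)
  back : x ∈ₗ as → ∃ λ y → semimemberᶠ as [ e ∷ x ∷ [] ]⇓ y
  back x∈as =
    0 , min⇓ (comp⇓ (proj⇓ ∷ []) (subst (memberᶠ as [ x ∷ [] ]⇓_) (from v≡0⇔ x∈as) p)) (λ _ ())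

module _ (N : AcceptableEnumeration) where
  open AcceptableEnumeration N

  -- `semimemberᶠ as` ignores its first argument, so the parameter 0 is an arbitrary choice.
  finiteIndex : List ℕ → ℕ
  finiteIndex as = proj₁ (parametrise (semimemberᶠ as)) 0

  W-finiteIndex : ∀ as → W N (finiteIndex as) ≐ (_∈ₗ as)
  W-finiteIndex as =
    (λ { {x} (y , p) → to (semimemberᶠ-domain as 0 x) (y , to (φ⇔ x y) p) }) ,
    (λ {x} x∈as → let y , p = from (semimemberᶠ-domain as 0 x) x∈as in y , from (φ⇔ x y) p)
    where
    φ⇔ : ∀ x y → φ (finiteIndex as) x y ⇔ semimemberᶠ as [ 0 ∷ x ∷ [] ]⇓ y
    φ⇔ = proj₂ (proj₂ (parametrise (semimemberᶠ as))) 0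

-- Least elements

-- The second argument is meant to be a known member bounding the search; when all smaller numbers
-- fail, it is returned untested.
least : {P : Pred ℕ 0ℓ} → Decidable P → ℕ → ℕ
least P? zero    = 0
least P? (suc n) with P? 0
... | yes _ = 0
... | no  _ = suc (least (P? ∘ suc) n)

least-∈ : {P : Pred ℕ 0ℓ} (P? : Decidable P) → ∀ {n} → n ∈ P → least P? n ∈ P
least-∈ P? {zero}  n∈P = n∈P
least-∈ P? {suc n} n∈P with P? 0
... | yes 0∈P = 0∈P
... | no  _   = least-∈ (P? ∘ suc) n∈P

-- Different bounds are allowed because `representative` bounds each search by its own argument.
least-cong : {P Q : Pred ℕ 0ℓ} (P? : Decidable P) (Q? : Decidable Q) → P ≐ Q →
             ∀ {m n} → m ∈ P → n ∈ Q → least P? m ≡ least Q? n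
least-cong P? Q? P≐Q {zero} {zero} m∈P n∈Q = refl
least-cong P? Q? (P⊆Q , _) {zero} {suc n} m∈P n∈Q with Q? 0
... | yes _  = refl
... | no 0∉Q = contradiction (P⊆Q m∈P) 0∉Q
least-cong P? Q? (_ , Q⊆P) {suc m} {zero} m∈P n∈Q with P? 0
... | yes _  = refl
... | no 0∉P = contradiction (Q⊆P n∈Q) 0∉P
least-cong P? Q? (P⊆Q , Q⊆P) {suc m} {suc n} m∈P n∈Q with P? 0 | Q? 0
... | yes _   | yes _   = refl
... | yes 0∈P | no 0∉Q  = contradiction (P⊆Q 0∈P) 0∉Q
... | no 0∉P  | yes 0∈Q = contradiction (Q⊆P 0∈Q) 0∉P
... | no _    | no _    = cong suc (least-cong (P? ∘ suc) (Q? ∘ suc) (P⊆Q , Q⊆P) m∈P n∈Q)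

module _ (em : ExcludedMiddle 0ℓ) {E : Rel ℕ 0ℓ} (isEq : IsEquivalence E) where
  private module E = IsEquivalence isEq

  representative : ℕ → ℕ
  representative n = least {λ m → E m n} (λ _ → em) n

  representative-E : ∀ n → E (representative n) n
  representative-E n = least-∈ {λ m → E m n} (λ _ → em) {n} E.refl

  representative-cong : ∀ {m n} → E m n → representative m ≡ representative n
  representative-cong {m} {n} m~n =
    least-cong (λ _ → em) (λ _ → em)
      ((λ l~m → E.trans l~m m~n) , (λ l~n → E.trans l~n (E.sym m~n))) {m} {n} E.refl E.refl

-- Prefixes and interleaving

prepend : {X : Set} → List X → (ℕ → X) → ℕ → X
prepend []      f n       = f n
prepend (x ∷ σ) f zero    = x
prepend (x ∷ σ) f (suc n) = prepend σ f n

applyUpTo-prepend : {X : Set} (σ : List X) (f : ℕ → X) → ∀ n →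
                    applyUpTo (prepend σ f) (length σ + n) ≡ σ ++ applyUpTo f n
applyUpTo-prepend []      f n = refl
applyUpTo-prepend (x ∷ σ) f n = cong (x ∷_) (applyUpTo-prepend σ f n)

prepend-+ : {X : Set} (σ : List X) (f : ℕ → X) → ∀ n → prepend σ f (length σ + n) ≡ f n
prepend-+ []      f n = refl
prepend-+ (x ∷ σ) f n = prepend-+ σ f n

prepend-All : {X : Set} {P : Pred X 0ℓ} {σ : List X} {f : ℕ → X} →
              All P σ → (∀ n → P (f n)) → ∀ n → P (prepend σ f n)
prepend-All []         Pf n       = Pf n
prepend-All (px ∷ pxs) Pf zero    = px
prepend-All (px ∷ pxs) Pf (suc n) = prepend-All pxs Pf n

-- The sequence is produced in blocks: when the queue is empty, the history h
-- is continued by the block hd h ∷ tl h.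
module Blocks {X : Set} (hd : List X → X) (tl : List X → List X) where

  State : Set
  State = List X × List X

  emit : State → X
  emit (h , [])    = hd h
  emit (h , x ∷ q) = x

  step : State → State
  step (h , [])    = h ∷ʳ hd h , tl h
  step (h , x ∷ q) = h ∷ʳ x , q

  state : ℕ → State
  state zero    = [] , []
  state (suc s) = step (state s)

  sequence : ℕ → X
  sequence s = emit (state s)

  step-history : ∀ st → proj₁ (step st) ≡ proj₁ st ∷ʳ emit st
  step-history (h , [])    = refl
  step-history (h , x ∷ q) = refl

  history : ∀ s → proj₁ (state s) ≡ applyUpTo sequence s
  history zero    = refl
  history (suc s) = begin
    proj₁ (step (state s))                ≡⟨ step-history (state s) ⟩
    proj₁ (state s) ∷ʳ sequence s         ≡⟨ cong (_∷ʳ sequence s) (history s) ⟩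
    applyUpTo sequence s ∷ʳ sequence s    ≡⟨ applyUpTo-∷ʳ sequence s ⟩
    applyUpTo sequence (suc s)            ∎
    where open ≡-Reasoning

  -- The remainder `r` allows stopping inside a block.
  run : ∀ {s h} q {r} → state s ≡ (h , q ++ r) → state (length q + s) ≡ (h ++ q , r)
  run {h = h} [] {r} eq = trans eq (cong (_, r) (sym (++-identityʳ h)))
  run {s} {h} (x ∷ q) {r} eq = begin
    state (suc (length q + s))  ≡⟨ cong state (+-suc (length q) s) ⟨
    state (length q + suc s)    ≡⟨ run q (cong step eq) ⟩
    (h ∷ʳ x ++ q , r)           ≡⟨ cong (_, r) (++-assoc h (x ∷ []) q) ⟩
    (h ++ x ∷ q , r)            ∎
    where open ≡-Reasoning

  run-block : ∀ {s h} p {r} → state s ≡ (h , []) → hd h ∷ tl h ≡ p ++ r →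
              proj₁ (state (length p + s)) ≡ h ++ p
  run-block {h = h} [] eq _ = trans (cong proj₁ eq) (sym (++-identityʳ h))
  run-block {s} {h} (x ∷ p) {r} eq block≡ with ∷-injective block≡
  ... | refl , tl≡ = begin
    proj₁ (state (suc (length p + s)))  ≡⟨ cong (proj₁ ∘ state) (+-suc (length p) s) ⟨
    proj₁ (state (length p + suc s))    ≡⟨ cong proj₁ (run p (trans (cong step eq) (cong (h ∷ʳ x ,_) tl≡))) ⟩
    h ∷ʳ x ++ p                         ≡⟨ ++-assoc h (x ∷ []) p ⟩
    h ++ x ∷ p                          ∎
    where open ≡-Reasoning

  -- All prefixes of the block are covered because `diverges` compares two points of the same block.
  BlockAt : ℕ → Set
  BlockAt s = ∀ p r → hd (applyUpTo sequence s) ∷ tl (applyUpTo sequence s) ≡ p ++ r →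
              applyUpTo sequence (length p + s) ≡ applyUpTo sequence s ++ p

  -- Once the queue pending at time `s₀` has been emitted, a new block begins.
  infinitely-many-blocks : ∀ s₀ → ∃ λ s → s₀ ≤ s × BlockAt s
  infinitely-many-blocks s₀ = s , m≤n+m s₀ (length q) , block
    where
    q = proj₂ (state s₀)
    s = length q + s₀
    h = proj₁ (state s₀) ++ q

    at-s : state s ≡ (h , [])
    at-s = run q (cong (proj₁ (state s₀) ,_) (sym (++-identityʳ q)))

    h≡ : h ≡ applyUpTo sequence s
    h≡ = trans (cong proj₁ (sym at-s)) (history s)

    block : BlockAt s
    block p r eq = trans (sym (history (length p + s)))
      (run-block p (trans at-s (cong (_, []) h≡)) eq)

-- Locking strings

module _ (em : ExcludedMiddle 0ℓ) {X : Set} (M : List X → ℕ) where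

  Locking : Pred (List X) 0ℓ
  Locking σ = ∀ τ → M (σ ++ τ) ≡ M σ

  Converges : (ℕ → X) → Set
  Converges μ = ∃ λ i → ∃ λ s₀ → ∀ s → s₀ ≤ s → M (applyUpTo μ s) ≡ i

  locking-string : (ν : ℕ → X) →
                   (∀ μ → (∀ n → ∃ λ s → μ s ≡ ν n) → Converges μ) →
                   Satisfiable Locking
  locking-string ν converges with em {Satisfiable Locking}
  ... | yes locking = locking
  ... | no ¬locking = contradiction (converges sequence covers) diverges
    where
    changes : ∀ σ → ∃ λ τ → M (σ ++ τ) ≢ M σ
    changes σ with em {∃ λ τ → M (σ ++ τ) ≢ M σ}
    ... | yes change = change
    ... | no ¬change = contradiction
      (σ , λ τ → decidable-stable (M (σ ++ τ) ≟ M σ) (λ ≢ → ¬change (τ , ≢))) ¬locking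

    -- The `suc` makes the block nonempty, with head `ν 0`; the growing length brings in every entry
    -- of `ν`.
    start : List X → List X
    start h = applyUpTo ν (suc (length h))

    change : List X → List X
    change h = proj₁ (changes (h ++ start h))

    -- By definition of `applyUpTo`, this head and tail together form `start h ++ change h`.
    open Blocks (λ _ → ν 0) (λ h → applyUpTo (ν ∘ suc) (length h) ++ change h)

    covers : ∀ n → ∃ λ s → sequence s ≡ ν n
    covers n with infinitely-many-blocks n
    ... | s , n≤s , block =
      let t , _ , eq = ∈-applyUpTo⁻ sequence ν-n∈ in t , sym eq
      where
      h = applyUpTo sequence s

      n<∣start∣ : n < suc (length h)
      n<∣start∣ = subst (λ l → n < suc l) (sym (length-applyUpTo sequence s))
                    (s≤s n≤s)

      ν-n∈ : ν n ∈ₗ applyUpTo sequence (length (start h) + s)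
      ν-n∈ = subst (ν n ∈ₗ_) (sym (block (start h) (change h) refl))
               (∈-++⁺ʳ h (∈-applyUpTo⁺ ν n<∣start∣))

    diverges : ¬ Converges sequence
    diverges (i , s₀ , M≡i) with infinitely-many-blocks s₀
    -- The conjectures just before and just after `change h` are both made at stages from `s₀` on,
    -- so both equal `i`.
    ... | s , s₀≤s , block = contradiction
      (trans (conjecture (start h ++ change h) [] (sym (++-identityʳ _)) ++-assoc′)
             (sym (conjecture (start h) (change h) refl refl)))
      (proj₂ (changes (h ++ start h)))
      where
      h = applyUpTo sequence s

      ++-assoc′ : h ++ start h ++ change h ≡ (h ++ start h) ++ change h
      ++-assoc′ = sym (++-assoc h (start h) (change h))

      conjecture : ∀ p r → start h ++ change h ≡ p ++ r →
                   ∀ {σ} → h ++ p ≡ σ → M σ ≡ i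
      conjecture p r eq refl = trans (cong M (sym (block p r eq)))
        (M≡i (length p + s) (≤-trans s₀≤s (m≤n+m s (length p))))

-- The default `a` replaces each number outside `A`; members stay at their own position, which makes
-- surjectivity immediate.
listing : ExcludedMiddle 0ℓ → {A : Pred ℕ 0ℓ} → Satisfiable A → ℕ → ∃ A
listing em {A} a x with em {A x}
... | yes x∈A = x , x∈A
... | no  _   = a

listing-∈ : (em : ExcludedMiddle 0ℓ) {A : Pred ℕ 0ℓ} (a : Satisfiable A) →
            ∀ {x} → x ∈ A → proj₁ (listing em a x) ≡ x
listing-∈ em {A} a {x} x∈A with em {A x}
... | yes _  = refl
... | no x∉A = contradiction x∈A x∉A

-- The two implications

module _ (em : ExcludedMiddle 0ℓ) (N : AcceptableEnumeration)
         (E : Rel ℕ 0ℓ) (isEq : IsEquivalence E) where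
  private module E = IsEquivalence isEq

  nonemptyCE : Family N
  nonemptyCE = record
    { member   = λ A → Satisfiable A × CE N A
    ; respects = λ { (A⊆B , B⊆A) ((a , a∈A) , e , W⊆A , A⊆W) →
                     (a , A⊆B a∈A) , e , (λ p → A⊆B (W⊆A p)) , (λ p → A⊆W (B⊆A p)) }
    ; nonempty = proj₁
    ; ce       = proj₂
    }

  universal⇒locking : Universal N E → LockingProperty N E
  universal⇒locking universal e a b _ increasing (⋃⊆W , W⊆⋃) =
    let k , σ⊆Wb = eventually-contained (a ∷ σ)
    in k , λ i k≤i → E.trans (E.sym (conjecture-E (b i) (λ p → ⋃⊆W (i , p)) (σ⊆Wb i k≤i)))
                             (conjecture-E e (λ p → p) (everywhere (a ∷ σ)))
    where
    M : Learner
    M = proj₁ (universal nonemptyCE)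

    learns : ∀ d → Satisfiable (W N d) → ∀ μ → μ Enumerates W N d →
             ∃ λ i → E i d × ∃ λ s₀ → ∀ s → s₀ ≤ s → M (μ ↾ s) ≡ i
    learns d d≢∅ = proj₂ (universal nonemptyCE) d (d≢∅ , d , (λ p → p) , (λ p → p))

    -- Over entries bundled with their membership in W e, every string is
    -- a string over W e.
    Mᵉ : List (∃ (W N e)) → ℕ
    Mᵉ σ = M (map proj₁ σ)

    lockingᵉ : Satisfiable (Locking em Mᵉ)
    lockingᵉ = locking-string em Mᵉ (listing em a) converges
      where
      converges : ∀ μ → (∀ n → ∃ λ s → μ s ≡ listing em a n) → Converges em Mᵉ μ
      converges μ covers =
        let i , _ , s₀ , M≡i = learns e a (proj₁ ∘ μ) (proj₂ ∘ μ , surjective)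
        in i , s₀ , λ s s₀≤s → trans (cong M (map-applyUpTo μ proj₁ s)) (M≡i s s₀≤s)
        where
        surjective : ∀ {x} → x ∈ W N e → ∃ λ s → proj₁ (μ s) ≡ x
        surjective {x} x∈W =
          let s , eq = covers x in s , trans (cong proj₁ eq) (listing-∈ em a x∈W)

    σ : List (∃ (W N e))
    σ = proj₁ lockingᵉ

    everywhere : (τ : List (∃ (W N e))) → All (λ x → proj₁ x ∈ W N e) τ
    everywhere []      = []
    everywhere (x ∷ τ) = proj₂ x ∷ everywhere τ

    -- The extra entry a provides that W d is nonempty.
    conjecture-E : ∀ d → W N d ⊆ W N e → All (λ x → proj₁ x ∈ W N d) (a ∷ σ) → E (Mᵉ σ) d
    conjecture-E d Wd⊆We (a∈Wd ∷ σ⊆Wd) =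
      let i , i~d , s₀ , M≡i = learns d d≢∅ (proj₁ ∘ μ) (μ∈Wd , surjective)
          -- Long enough both to extend `σ` and to lie beyond the point of convergence.
          n = length σ + s₀
      in subst (λ j → E j d)
           (trans (sym (M≡i n (m≤n+m s₀ (length σ)))) (locked s₀))
           i~d
      where
      d≢∅ : Satisfiable (W N d)
      d≢∅ = proj₁ a , a∈Wd

      -- Lists `W N d`, but with proofs of membership in `W N e`, so that it can continue `σ`.
      f : ℕ → ∃ (W N e)
      f x = let y , y∈Wd = listing em d≢∅ x in y , Wd⊆We y∈Wd

      μ : ℕ → ∃ (W N e)
      μ = prepend σ f

      μ∈Wd : ∀ s → proj₁ (μ s) ∈ W N d
      μ∈Wd = prepend-All σ⊆Wd (λ x → proj₂ (listing em d≢∅ x))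

      surjective : ∀ {x} → x ∈ W N d → ∃ λ s → proj₁ (μ s) ≡ x
      surjective {x} x∈Wd =
        length σ + x , trans (cong proj₁ (prepend-+ σ f x)) (listing-∈ em d≢∅ x∈Wd)

      locked : ∀ s → M ((proj₁ ∘ μ) ↾ (length σ + s)) ≡ Mᵉ σ
      locked s = begin
        M ((proj₁ ∘ μ) ↾ (length σ + s))  ≡⟨ cong M (map-applyUpTo μ proj₁ (length σ + s)) ⟨
        Mᵉ (applyUpTo μ (length σ + s))   ≡⟨ cong Mᵉ (applyUpTo-prepend σ f s) ⟩
        Mᵉ (σ ++ applyUpTo f s)           ≡⟨ proj₂ lockingᵉ (applyUpTo f s) ⟩
        Mᵉ σ                              ∎
        where open ≡-Reasoning

    increasing-≤′ : ∀ {i j} → i ≤′ j → W N (b i) ⊆ W N (b j)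
    increasing-≤′ ≤′-refl       p = p
    increasing-≤′ (≤′-step i≤j) p = increasing _ (increasing-≤′ i≤j p)

    -- Each entry belongs to `W N (b i)` from some stage on; the maximum of these finitely many
    -- stages serves all entries.
    eventually-contained : (τ : List (∃ (W N e))) →
      ∃ λ k → ∀ i → k ≤ i → All (λ x → proj₁ x ∈ W N (b i)) τ
    eventually-contained [] = 0 , λ _ _ → []
    eventually-contained ((x , x∈W) ∷ τ) =
      let j , x∈Wbj = W⊆⋃ x∈W
          k , τ⊆Wb = eventually-contained τ
      in j ⊔ k , λ i j⊔k≤i →
           increasing-≤′ (≤⇒≤′ (≤-trans (m≤m⊔n j k) j⊔k≤i)) x∈Wbj ∷
           τ⊆Wb i (≤-trans (m≤n⊔m j k) j⊔k≤i)

  locking⇒universal : LockingProperty N E → Universal N E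
  locking⇒universal locking 𝔎 = M , learns
    where
    M : Learner
    M σ = representative em isEq (finiteIndex N σ)

    learns : Learns N E M 𝔎
    learns e W∈𝔎 μ (μ∈W , surjective) =
      let k , b~e = locking e (Family.nonempty 𝔎 W∈𝔎) b finite increasing (⋃⊆W , W⊆⋃)
      -- The conjectures must become one and the same number; that number is `representative e`,
      -- which need not be `e`.
      in representative em isEq e , representative-E em isEq e ,
         k , λ s k≤s → representative-cong em isEq (b~e s k≤s)
      where
      b : ℕ → ℕ
      -- At `s = 0` this is an index of the empty set, which the locking property allows.
      b s = finiteIndex N (μ ↾ s)

      finite : ∀ s → Finite (W N (b s))
      finite s = μ ↾ s , W-finiteIndex N (μ ↾ s)

      increasing : ∀ s → W N (b s) ⊆ W N (b (suc s))
      increasing s {x} x∈Wb = proj₂ (W-finiteIndex N (μ ↾ suc s))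
        (subst (x ∈ₗ_) (applyUpTo-∷ʳ μ s) (∈-++⁺ˡ (proj₁ (W-finiteIndex N (μ ↾ s)) x∈Wb)))

      ⋃⊆W : ∀ {x} → (∃ λ s → x ∈ W N (b s)) → x ∈ W N e
      ⋃⊆W (s , x∈Wb) =
        let t , _ , x≡μt = ∈-applyUpTo⁻ μ (proj₁ (W-finiteIndex N (μ ↾ s)) x∈Wb)
        in subst (W N e) (sym x≡μt) (μ∈W t)

      W⊆⋃ : ∀ {x} → x ∈ W N e → ∃ λ s → x ∈ W N (b s)
      W⊆⋃ {x} x∈W =
        let t , μt≡x = surjective x∈W
        -- The string of length `t` stops just before position `t`, so `suc t` entries are taken to
        -- include `μ t`.
        in suc t , proj₂ (W-finiteIndex N (μ ↾ suc t))
             (subst (_∈ₗ μ ↾ suc t) μt≡x (∈-applyUpTo⁺ μ (n<1+n t)))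

theorem3p10 : ExcludedMiddle 0ℓ →
    (N : AcceptableEnumeration) →
    (E : Rel ℕ 0ℓ) → IsEquivalence E → EqCE N ⇒ E →
    Universal N E ⇔ LockingProperty N E
theorem3p10 em N E isEq _ =
  mk⇔ (universal⇒locking em N E isEq) (locking⇒universal em N E isEq)
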